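{- The axiomatic system $\mathbf{KB5}^\circ$ is sound and strongly complete with respect to the class of $\mathcal{B}5$-frames (symmetric and Euclidean frames). That is, with $F$ the class of symmetric and Euclidean frames: every theorem of $\mathbf{KB5}^\circ$ is valid on $F$ (soundness), and for every set $\Gamma\cup\{\phi\}$ of $\mathcal{L}(\circ)$-formulas, if $\Gamma\vDash_F\phi$ then $\Gamma\vdash_{\mathbf{KB5}^\circ}\phi$ (strong completeness).
   Context: Let $\mathbf{P}$ be a set of propositional variables, with $p,q\in\mathbf{P}$ distinct. The language $\mathcal{L}(\circ)$ is given by $\phi::=r\mid\neg\phi\mid(\phi\land\phi)\mid\circ\phi$ with $r\in\mathbf{P}$; other Boolean connectives and $\top$ are the usual abbreviations. A frame is $\langle S,R\rangle$ with $S$ a nonempty set and $R\subseteq S\times S$; it is symmetric if $R$ is, and Euclidean if $xRy$ and $xRz$ imply $yRz$. A model based on a frame is $\mathcal{M}=\langle S,R,V\rangle$ with $V:\mathbf{P}\to\mathcal{P}(S)$. Satisfaction: $\mathcal{M},s\vDash r$ iff $s\in V(r)$; Booleans as usual; $\mathcal{M},s\vDash\circ\phi$ iff ($\mathcal{M},s\vDash\phi$ implies that $\mathcal{M},t\vDash\phi$ for all $t$ with $sRt$). For a class $F$ of frames, $\phi$ is valid on $F$ if $\mathcal{M},s\vDash\phi$ for every model $\mathcal{M}$ based on a frame in $F$ and every $s$ in $\mathcal{M}$; $\Gamma\vDash_F\phi$ means: for every model $\mathcal{M}$ based on a frame in $F$ and every $s$ in $\mathcal{M}$, if $\mathcal{M},s\vDash\gamma$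 for all $\gamma\in\Gamma$ then $\mathcal{M},s\vDash\phi$. The system $\mathbf{K}^\circ$ has as axioms all propositional tautologies, $\circ\top$, $\neg p\to\circ p$, and $\circ p\land\circ q\to\circ(p\land q)$, and as inference rules uniform substitution, modus ponens, and the rule: from $\phi\to\psi$ infer $\circ\phi\land\phi\to\circ\psi$. The system $\mathbf{KB5}^\circ$ is $\mathbf{K}^\circ$ plus the axioms $p\to\circ(\circ\neg p\to p)$ and $\neg\circ\neg p\to\circ(\circ\neg p\to p)$. A derivation from $\Gamma$ to $\phi$ in a system, written $\Gamma\vdash\phi$ (with the system as subscript), is a finite sequence of $\mathcal{L}(\circ)$-formulas (ending in $\phi$) in which each formula is either an instantiation of an axiom, or an element of $\Gamma$, or the result of applying an inference rule to prior formulas in the sequence. A theorem is a formula $\phi$ for which there is a derivation from $\emptyset$ to $\phi$. -}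

module Defs where

open import Level using (0ℓ)
open import Data.Bool.Base as Bool using (Bool; true)
open import Data.List.Base using (List; []; _∷_)
open import Data.List.Membership.Propositional using (_∈_)
open import Data.Product.Base using (_×_; ∃-syntax)
open import Relation.Binary.Core using (Rel)
open import Relation.Binary.Definitions using (Symmetric)
open import Relation.Binary.PropositionalEquality.Core using (_≡_)
open import Relation.Nullary.Negation.Core using (¬_)
open import Relation.Unary using (Pred; ∅)

infix  9 ∼_ ∘_
infixr 7 _∧_
infixr 5 _⇒_

data Formula (P : Set) : Set where
  var : P → Formula P
  ∼_  : Formula P → Formula P
  _∧_ : Formula P → Formula P → Formula P
  ∘_  : Formula P → Formula P

_⇒_ : {P : Set} → Formula P → Formula P → Formula P
φ ⇒ ψ = ∼ (φ ∧ ∼ ψ)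

-- ⊤ abbreviates an arbitrary tautology, so a variable has to be supplied.
⊤[_] : {P : Set} → P → Formula P
⊤[ p ] = ∼ (var p ∧ ∼ var p)

_[_] : {P : Set} → Formula P → (P → Formula P) → Formula P
var r   [ σ ] = σ r
(∼ φ)   [ σ ] = ∼ (φ [ σ ])
(φ ∧ ψ) [ σ ] = (φ [ σ ]) ∧ (ψ [ σ ])
(∘ φ)   [ σ ] = ∘ (φ [ σ ])

record Frame : Set₁ where
  field
    S         : Set
    R         : Rel S 0ℓ
    inhabited : S

Euclidean : {S : Set} → Rel S 0ℓ → Set
Euclidean R = ∀ {x y z} → R x y → R x z → R y z

B5 : Pred Frame 0ℓ
B5 F = Symmetric R × Euclidean R
  where open Frame F

Valuation : Set → Frame → Set₁
Valuation P F = P → Pred (Frame.S F) 0ℓ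

Sat : {P : Set} (F : Frame) → Valuation P F → Frame.S F → Formula P → Set
Sat F V s (var r) = V r s
Sat F V s (∼ φ)   = ¬ Sat F V s φ
Sat F V s (φ ∧ ψ) = Sat F V s φ × Sat F V s ψ
Sat F V s (∘ φ)   = Sat F V s φ → ∀ t → Frame.R F s t → Sat F V t φ

ValidOn : {P : Set} → Pred Frame 0ℓ → Formula P → Set₁
ValidOn {P} C φ = ∀ F → C F → (V : Valuation P F) (s : Frame.S F) → Sat F V s φ

Entails : {P : Set} → Pred Frame 0ℓ → Pred (Formula P) 0ℓ → Formula P → Set₁
Entails {P} C Γ φ =
  ∀ F → C F → (V : Valuation P F) (s : Frame.S F) →
  (∀ γ → Γ γ → Sat F V s γ) → Sat F V s φ

-- Truth-table evaluation in which variables and formulas ∘ φ are treated as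
-- independent atoms; the value of v on other formulas is never consulted.
eval : {P : Set} → (Formula P → Bool) → Formula P → Bool
eval v (var r) = v (var r)
eval v (∼ φ)   = Bool.not (eval v φ)
eval v (φ ∧ ψ) = eval v φ Bool.∧ eval v ψ
eval v (∘ φ)   = v (∘ φ)

Tautology : {P : Set} → Pred (Formula P) 0ℓ
Tautology φ = ∀ v → eval v φ ≡ true

data K°-Axiom {P : Set} (p q : P) : Pred (Formula P) 0ℓ where
  tautology : ∀ {φ} → Tautology φ → K°-Axiom p q φ
  ∘⊤        : K°-Axiom p q (∘ ⊤[ p ])
  ∼p⇒∘p     : K°-Axiom p q (∼ var p ⇒ ∘ var p)
  ∘p∧∘q     : K°-Axiom p q (∘ var p ∧ ∘ var q ⇒ ∘ (var p ∧ var q))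

data KB5°-Axiom {P : Set} (p q : P) : Pred (Formula P) 0ℓ where
  K°     : ∀ {φ} → K°-Axiom p q φ → KB5°-Axiom p q φ
  p⇒     : KB5°-Axiom p q (var p ⇒ ∘ (∘ (∼ var p) ⇒ var p))
  ∼∘∼p⇒  : KB5°-Axiom p q (∼ (∘ (∼ var p)) ⇒ ∘ (∘ (∼ var p) ⇒ var p))

-- The rules apply to arbitrary prior formulas, including ones that
-- depend on premises from Γ.
data Justified {P : Set} (Ax Γ : Pred (Formula P) 0ℓ)
               (prior : List (Formula P)) : Pred (Formula P) 0ℓ where
  axiom-instance       : ∀ {α} → Ax α → (σ : P → Formula P) →
                         Justified Ax Γ prior (α [ σ ])
  premise              : ∀ {φ} → Γ φ → Justified Ax Γ prior φ
  uniform-substitution : ∀ {φ} → φ ∈ prior → (σ : P → Formula P) →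
                         Justified Ax Γ prior (φ [ σ ])
  modus-ponens         : ∀ {φ ψ} → (φ ⇒ ψ) ∈ prior → φ ∈ prior →
                         Justified Ax Γ prior ψ
  ∘-monotonicity       : ∀ {φ ψ} → (φ ⇒ ψ) ∈ prior →
                         Justified Ax Γ prior (∘ φ ∧ φ ⇒ ∘ ψ)

-- Sequences are listed in reverse: the head is the last formula.
data IsDerivation {P : Set} (Ax Γ : Pred (Formula P) 0ℓ) :
                  Pred (List (Formula P)) 0ℓ where
  []  : IsDerivation Ax Γ []
  _∷_ : ∀ {φ φs} → Justified Ax Γ φs φ → IsDerivation Ax Γ φs →
        IsDerivation Ax Γ (φ ∷ φs)

Derives : {P : Set} (Ax Γ : Pred (Formula P) 0ℓ) → Formula P → Set
Derives Ax Γ φ = ∃[ φs ] IsDerivation Ax Γ (φ ∷ φs)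

Theorem : {P : Set} (Ax : Pred (Formula P) 0ℓ) → Formula P → Set
Theorem Ax φ = Derives Ax ∅ φ

{-# OPTIONS --safe #-}
-- Put □φ = φ ∧ ∘φ.  Then □ is a normal modality, ∘φ amounts to φ ⇒ □φ, and the
-- two characteristic axioms yield ∼□φ ⇒ □∼□φ, so the canonical relation "□φ ∈ w
-- implies φ ∈ u" is symmetric and Euclidean.  No choice principle is needed to
-- get enough worlds: the formulas derivable from Γ are closed under uniform
-- substitution, so all variables outside φ may be collapsed to one variable, and
-- worlds need only decide the countably many formulas that remain.
module Submission where

open import Defs
open import Level using (0ℓ)
open import Axiom.ExcludedMiddle using (ExcludedMiddle)
open import Axiom.Extensionality.Propositional using (Extensionality)
open import Data.Bool.Base using (Bool; true; false; T)
open import Data.List.Base using (List; []; _∷_; _++_; map; foldl; cartesianProductWith)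
open import Data.List.Membership.Propositional using (_∈_)
open import Data.List.Membership.Propositional.Properties
  using (∈-++⁺ˡ; ∈-++⁺ʳ; ∈-map⁺; ∈-cartesianProductWith⁺)
open import Data.List.Relation.Binary.Subset.Propositional using (_⊆_)
open import Data.List.Relation.Unary.All using (All; []; _∷_; lookup)
open import Data.List.Relation.Unary.Any using (here; there)
open import Data.Nat.Base using (ℕ; zero; suc; _⊔_; _≤′_; ≤′-refl; ≤′-step)
open import Data.Nat.Properties using (≤⇒≤′; m≤m⊔n; m≤n⊔m)
open import Data.Product.Base using (_×_; _,_; proj₁; proj₂; ∃-syntax; -,_)
open import Data.Sum.Base as ⊎ using (_⊎_; inj₁; inj₂)
open import Function.Base using (_∘′_)
open import Relation.Binary.PropositionalEquality
  using (_≡_; _≢_; refl; sym; cong; cong₂; subst; subst₂)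
open import Relation.Nullary.Decidable
  using (yes; no; ⌊_⌋; toWitness; fromWitness; decidable-stable)
open import Relation.Nullary.Negation using (¬_; contradiction)
open import Relation.Unary using (Pred; ∅; _∉_) renaming (_⊆_ to _⊑_)

-- The box modality and substitution

infix 9 □_

□_ : {P : Set} → Formula P → Formula P
□ φ = φ ∧ ∘ φ

variables : {P : Set} → Formula P → List P
variables (var r) = r ∷ []
variables (∼ φ)   = variables φ
variables (φ ∧ ψ) = variables φ ++ variables ψ
variables (∘ φ)   = variables φ

-- Serves twice: with `var` it strips the identity substitution from an axiom instance, and with the
-- collapsing substitution `τ` it keeps the formula to be refuted unchanged.
[]-fixed : {P : Set} (φ : Formula P) {τ : P → Formula P} →
           (∀ {r} → r ∈ variables φ → τ r ≡ var r) → φ [ τ ] ≡ φ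
[]-fixed (var r) fix = fix (here refl)
[]-fixed (∼ φ)   fix = cong ∼_ ([]-fixed φ fix)
[]-fixed (φ ∧ ψ) fix =
  cong₂ _∧_ ([]-fixed φ (fix ∘′ ∈-++⁺ˡ)) ([]-fixed ψ (fix ∘′ ∈-++⁺ʳ (variables φ)))
[]-fixed (∘ φ)   fix = cong ∘_ ([]-fixed φ fix)

-- Tautologies

module _ {P : Set} (φ ψ : Formula P) where

  weakening-tautology : Tautology (φ ⇒ ψ ⇒ φ)
  weakening-tautology v with eval v φ | eval v ψ
  ... | false | _     = refl
  ... | true  | false = refl
  ... | true  | true  = refl

  ∧-elimˡ-tautology : Tautology (φ ∧ ψ ⇒ φ)
  ∧-elimˡ-tautology v with eval v φ | eval v ψ
  ... | false | _     = refl
  ... | true  | false = refl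
  ... | true  | true  = refl

  ∧-elimʳ-tautology : Tautology (φ ∧ ψ ⇒ ψ)
  ∧-elimʳ-tautology v with eval v φ | eval v ψ
  ... | false | _     = refl
  ... | true  | false = refl
  ... | true  | true  = refl

  ∧-intro-tautology : Tautology (φ ⇒ ψ ⇒ φ ∧ ψ)
  ∧-intro-tautology v with eval v φ | eval v ψ
  ... | false | _     = refl
  ... | true  | false = refl
  ... | true  | true  = refl

  explosion-tautology : Tautology (∼ φ ⇒ φ ⇒ ψ)
  explosion-tautology v with eval v φ
  ... | false = refl
  ... | true  = refl

  contraposition-tautology : Tautology ((φ ⇒ ∼ ψ) ⇒ ψ ⇒ ∼ φ)
  contraposition-tautology v with eval v φ | eval v ψ
  ... | false | false = refl
  ... | false | true  = refl
  ... | true  | false = refl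
  ... | true  | true  = refl

module _ {P : Set} (φ : Formula P) where

  double-negation-intro-tautology : Tautology (φ ⇒ ∼ ∼ φ)
  double-negation-intro-tautology v with eval v φ
  ... | false = refl
  ... | true  = refl

  double-negation-elim-tautology : Tautology (∼ ∼ φ ⇒ φ)
  double-negation-elim-tautology v with eval v φ
  ... | false = refl
  ... | true  = refl

module _ {P : Set} (φ ψ χ : Formula P) where

  distribution-tautology : Tautology ((φ ⇒ ψ ⇒ χ) ⇒ (φ ⇒ ψ) ⇒ φ ⇒ χ)
  distribution-tautology v with eval v φ | eval v ψ | eval v χ
  ... | false | _     | _     = refl
  ... | true  | false | _     = refl
  ... | true  | true  | false = refl
  ... | true  | true  | true  = refl

  cases-tautology : Tautology ((φ ∧ ψ ⇒ χ) ⇒ (φ ∧ ∼ ψ ⇒ χ) ⇒ φ ⇒ χ)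
  cases-tautology v with eval v φ | eval v ψ | eval v χ
  ... | false | _     | _     = refl
  ... | true  | false | false = refl
  ... | true  | false | true  = refl
  ... | true  | true  | false = refl
  ... | true  | true  | true  = refl

-- Theories closed under modus ponens

-- Shared by derivability from `Γ`, its relativisation to an antecedent, worlds, and the formulas
-- boxed in a world, so propositional reasoning is done once for all of them.
record IsFilter {P : Set} (Θ : Pred (Formula P) 0ℓ) : Set where
  field
    tautological : ∀ {φ} → Tautology φ → Θ φ
    detach       : ∀ {φ ψ} → Θ (φ ⇒ ψ) → Θ φ → Θ ψ

  ∧-intro : ∀ {φ ψ} → Θ φ → Θ ψ → Θ (φ ∧ ψ)
  ∧-intro {φ} {ψ} x y = detach (detach (tautological (∧-intro-tautology φ ψ)) x) y

  ∧-elimˡ : ∀ {φ ψ} → Θ (φ ∧ ψ) → Θ φ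
  ∧-elimˡ {φ} {ψ} = detach (tautological (∧-elimˡ-tautology φ ψ))

  ∧-elimʳ : ∀ {φ ψ} → Θ (φ ∧ ψ) → Θ ψ
  ∧-elimʳ {φ} {ψ} = detach (tautological (∧-elimʳ-tautology φ ψ))

  weakening : ∀ {φ ψ} → Θ φ → Θ (ψ ⇒ φ)
  weakening {φ} {ψ} = detach (tautological (weakening-tautology φ ψ))

  explosion : ∀ {φ ψ} → Θ (∼ φ) → Θ (φ ⇒ ψ)
  explosion {φ} {ψ} = detach (tautological (explosion-tautology φ ψ))

  contraposition : ∀ {φ ψ} → Θ (φ ⇒ ∼ ψ) → Θ (ψ ⇒ ∼ φ)
  contraposition {φ} {ψ} = detach (tautological (contraposition-tautology φ ψ))

  ∼∼-intro : ∀ {φ} → Θ φ → Θ (∼ ∼ φ)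
  ∼∼-intro {φ} = detach (tautological (double-negation-intro-tautology φ))

  distribution : ∀ {φ ψ χ} → Θ (φ ⇒ ψ ⇒ χ) → Θ (φ ⇒ ψ) → Θ (φ ⇒ χ)
  distribution {φ} {ψ} {χ} x = detach (detach (tautological (distribution-tautology φ ψ χ)) x)

  cases : ∀ {φ ψ χ} → Θ (φ ∧ ψ ⇒ χ) → Θ (φ ∧ ∼ ψ ⇒ χ) → Θ (φ ⇒ χ)
  cases {φ} {ψ} {χ} x = detach (detach (tautological (cases-tautology φ ψ χ)) x)

  ⇒-refl : ∀ {φ} → Θ (φ ⇒ φ)
  ⇒-refl {φ} = distribution {ψ = φ ⇒ φ} (tautological (weakening-tautology φ (φ ⇒ φ)))
                                        (tautological (weakening-tautology φ φ))

  ⇒-trans : ∀ {φ ψ χ} → Θ (φ ⇒ ψ) → Θ (ψ ⇒ χ) → Θ (φ ⇒ χ)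
  ⇒-trans x y = distribution (weakening y) x

  -- Replaces the deduction theorem, which fails in general because substitution may act on
  -- premises: reasoning under the hypothesis `α` takes place in this filter.
  adjoin-isFilter : ∀ α → IsFilter (λ χ → Θ (α ⇒ χ))
  adjoin-isFilter α = record
    { tautological = λ t → weakening (tautological t)
    ; detach       = distribution
    }

module Classical (em : ExcludedMiddle 0ℓ) where

  -- Worlds must form a small type, hence are Boolean-valued.
  ⟦_⟧ : {A : Set} → Pred A 0ℓ → A → Bool
  ⟦ X ⟧ a = ⌊ em {X a} ⌋

  stable : {A : Set} → ¬ ¬ A → A
  stable = decidable-stable em

  -- Soundness

  module _ {P : Set} (F : Frame) (V : Valuation P F) where

    Sat-⇒ : ∀ {s} φ ψ → Sat F V s (φ ⇒ ψ) → Sat F V s φ → Sat F V s ψ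
    Sat-⇒ φ ψ x y = stable λ z → x (y , z)

    -- Excluded middle settles variables and `∘`-formulas, the atoms of the truth table; the Boolean
    -- cases then follow the table. Hence tautologies hold at every point.
    Sat-eval : ∀ s φ → let v = ⟦ Sat F V s ⟧ in
               (eval v φ ≡ true → Sat F V s φ) × (Sat F V s φ → eval v φ ≡ true)
    Sat-eval s (var r) with em {V r s}
    ... | yes x = (λ _ → x) , λ _ → refl
    ... | no ¬x = (λ ()) , λ x → contradiction x ¬x
    Sat-eval s (∼ φ) with eval ⟦ Sat F V s ⟧ φ | Sat-eval s φ
    ... | true  | to , from = (λ ()) , λ ¬x → contradiction (to refl) ¬x
    ... | false | to , from = (λ _ x → contradiction (from x) λ ()) , λ _ → refl
    Sat-eval s (φ ∧ ψ) with eval ⟦ Sat F V s ⟧ φ | Sat-eval s φ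
    ... | true  | to , from = (λ e → to refl , proj₁ (Sat-eval s ψ) e) ,
                              λ xy → proj₂ (Sat-eval s ψ) (proj₂ xy)
    ... | false | to , from = (λ ()) , λ xy → from (proj₁ xy)
    Sat-eval s (∘ φ) with em {Sat F V s (∘ φ)}
    ... | yes x = (λ _ → x) , λ _ → refl
    ... | no ¬x = (λ ()) , λ x → contradiction x ¬x

  -- Both directions are proved together since `∼_` and the antecedent hidden in `∘_` swap them.
  Sat-[] : ∀ {P F} (V : Valuation P F) (σ : P → Formula P) φ s →
           let V′ = λ r t → Sat F V t (σ r) in
           (Sat F V s (φ [ σ ]) → Sat F V′ s φ) × (Sat F V′ s φ → Sat F V s (φ [ σ ]))
  Sat-[] V σ (var r) s = (λ x → x) , λ x → x
  Sat-[] V σ (∼ φ)   s = (λ ¬x x → ¬x (proj₂ (Sat-[] V σ φ s) x)) ,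
                         λ ¬x x → ¬x (proj₁ (Sat-[] V σ φ s) x)
  Sat-[] V σ (φ ∧ ψ) s =
    (λ (x , y) → proj₁ (Sat-[] V σ φ s) x , proj₁ (Sat-[] V σ ψ s) y) ,
    λ (x , y) → proj₂ (Sat-[] V σ φ s) x , proj₂ (Sat-[] V σ ψ s) y
  Sat-[] V σ (∘ φ)   s =
    (λ f x t sRt → proj₁ (Sat-[] V σ φ t) (f (proj₂ (Sat-[] V σ φ s) x) t sRt)) ,
    λ f x t sRt → proj₂ (Sat-[] V σ φ t) (f (proj₁ (Sat-[] V σ φ s) x) t sRt)

  valid-[] : ∀ {P} {C : Pred Frame 0ℓ} {φ : Formula P} →
             ValidOn C φ → ∀ σ → ValidOn C (φ [ σ ])
  valid-[] {φ = φ} valid σ F c V s = proj₂ (Sat-[] V σ φ s) (valid F c _ s)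

  axiom-valid : ∀ {P} {p q : P} {φ} → KB5°-Axiom p q φ → ValidOn B5 φ
  axiom-valid (K° (tautology {φ} t)) F c V s = proj₁ (Sat-eval F V s φ) (t _)
  axiom-valid (K° ∘⊤) F c V s _ t _ (x , ¬x) = ¬x x
  axiom-valid (K° ∼p⇒∘p) F c V s (¬x , ¬∘x) = ¬∘x λ x → contradiction x ¬x
  axiom-valid (K° ∘p∧∘q) F c V s ((f , g) , ¬h) =
    ¬h λ (x , y) t sRt → f x t sRt , g y t sRt
  -- Symmetry leads from `t` back to `s`, where `p` holds, while `∼ p` and `∘ ∼ p` at `t` exclude
  -- this.
  axiom-valid p⇒ F (symmetric , _) V s (x , ¬h) =
    ¬h λ _ t sRt (g , ¬y) → g ¬y s (symmetric sRt) x
  -- Points seen from `s` are seen from `t`, so `∼ p` and `∘ ∼ p` at `t` falsify `p` at all of them,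
  -- which gives `∘ ∼ p` at `s`.
  axiom-valid ∼∘∼p⇒ F (_ , euclidean) V s (¬g , ¬h) =
    ¬h λ _ t sRt (g , ¬y) → ¬g λ _ u sRu → g ¬y u (euclidean sRt sRu)

  -- Uniform substitution and `∘-monotonicity` preserve validity but not truth at a point, so
  -- validity is what the induction carries.
  justified-valid : ∀ {P} {p q : P} {φs φ} → All (ValidOn B5) φs →
                    Justified (KB5°-Axiom p q) ∅ φs φ → ValidOn B5 φ
  justified-valid vs (axiom-instance {α} a σ) = valid-[] {φ = α} (axiom-valid a) σ
  justified-valid vs (uniform-substitution {φ} i σ) = valid-[] {φ = φ} (lookup vs i) σ
  justified-valid vs (modus-ponens {φ} {ψ} i j) F c V s =
    Sat-⇒ F V φ ψ (lookup vs i F c V s) (lookup vs j F c V s)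
  justified-valid vs (∘-monotonicity {φ} {ψ} i) F c V s ((f , x) , ¬g) =
    ¬g λ _ t sRt → Sat-⇒ F V φ ψ (lookup vs i F c V t) (f x t sRt)

  derivation-valid : ∀ {P} {p q : P} {φs} →
                     IsDerivation (KB5°-Axiom p q) ∅ φs → All (ValidOn B5) φs
  derivation-valid []      = []
  derivation-valid (j ∷ d) = justified-valid vs j ∷ vs
    where vs = derivation-valid d

  -- Lindenbaum's lemma

  module Lindenbaum {P : Set} (level : ℕ → List (Formula P))
                    {Θ : Pred (Formula P) 0ℓ} (Θ-isFilter : IsFilter Θ)
                    (φ : Formula P) (φ∉Θ : φ ∉ Θ) where
    open IsFilter Θ-isFilter

    -- All decisions made so far are kept as one conjunction `α`.
    extend : Formula P → Formula P → Formula P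
    extend α ψ with em {Θ (α ∧ ψ ⇒ φ)}
    ... | yes _ = α ∧ ∼ ψ
    ... | no  _ = α ∧ ψ

    extend-⇒ : ∀ α ψ → Θ (extend α ψ ⇒ α)
    extend-⇒ α ψ with em {Θ (α ∧ ψ ⇒ φ)}
    ... | yes _ = tautological (∧-elimˡ-tautology α (∼ ψ))
    ... | no  _ = tautological (∧-elimˡ-tautology α ψ)

    extend-decides : ∀ α ψ → Θ (extend α ψ ⇒ ψ) ⊎ Θ (extend α ψ ⇒ ∼ ψ)
    extend-decides α ψ with em {Θ (α ∧ ψ ⇒ φ)}
    ... | yes _ = inj₂ (tautological (∧-elimʳ-tautology α (∼ ψ)))
    ... | no  _ = inj₁ (tautological (∧-elimʳ-tautology α ψ))

    -- If `α ∧ ψ` and `α ∧ ∼ ψ` both led to `φ`, so would `α`; thus negating `ψ` is safe whenever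
    -- asserting it is not.
    extend-avoids : ∀ α ψ → ¬ Θ (α ⇒ φ) → ¬ Θ (extend α ψ ⇒ φ)
    extend-avoids α ψ α⇏φ with em {Θ (α ∧ ψ ⇒ φ)}
    ... | yes x = λ y → α⇏φ (cases x y)
    ... | no ¬x = ¬x

    extendAll-⇒ : ∀ α ψs → Θ (foldl extend α ψs ⇒ α)
    extendAll-⇒ α []       = ⇒-refl
    extendAll-⇒ α (ψ ∷ ψs) = ⇒-trans (extendAll-⇒ (extend α ψ) ψs) (extend-⇒ α ψ)

    extendAll-decides : ∀ α {ψ ψs} → ψ ∈ ψs →
                        Θ (foldl extend α ψs ⇒ ψ) ⊎ Θ (foldl extend α ψs ⇒ ∼ ψ)
    extendAll-decides α {ψ} {_ ∷ ψs} (here refl) with extend-decides α ψ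
    ... | inj₁ x = inj₁ (⇒-trans (extendAll-⇒ _ ψs) x)
    ... | inj₂ x = inj₂ (⇒-trans (extendAll-⇒ _ ψs) x)
    extendAll-decides α (there i) = extendAll-decides _ i

    extendAll-avoids : ∀ α ψs → ¬ Θ (α ⇒ φ) → ¬ Θ (foldl extend α ψs ⇒ φ)
    extendAll-avoids α []       α⇏φ = α⇏φ
    extendAll-avoids α (ψ ∷ ψs) α⇏φ = extendAll-avoids _ ψs (extend-avoids α ψ α⇏φ)

    stage : ℕ → Formula P
    -- A tautology in the role of the empty conjunction.
    stage zero    = φ ⇒ φ
    stage (suc n) = foldl extend (stage n) (level n)

    stage-avoids : ∀ n → ¬ Θ (stage n ⇒ φ)
    stage-avoids zero    x = φ∉Θ (detach x ⇒-refl)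
    stage-avoids (suc n) = extendAll-avoids _ (level n) (stage-avoids n)

    stage-⇒ : ∀ {m n} → m ≤′ n → Θ (stage n ⇒ stage m)
    stage-⇒ ≤′-refl             = ⇒-refl
    stage-⇒ (≤′-step {n} m≤n) = ⇒-trans (extendAll-⇒ _ (level n)) (stage-⇒ m≤n)

    limit : Pred (Formula P) 0ℓ
    limit χ = ∃[ n ] Θ (stage n ⇒ χ)

    limit-isFilter : IsFilter limit
    limit-isFilter = record
      { tautological = λ t → 0 , weakening (tautological t)
      ; detach = λ (m , x) (n , y) → m ⊔ n ,
          distribution (⇒-trans (stage-⇒ (≤⇒≤′ (m≤m⊔n m n))) x)
                       (⇒-trans (stage-⇒ (≤⇒≤′ (m≤n⊔m m n))) y)
      }

    limit-extends : Θ ⊑ limit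
    limit-extends x = 0 , weakening x

    limit-avoids : φ ∉ limit
    limit-avoids (n , x) = stage-avoids n x

    limit-decides : ∀ n {ψ} → ψ ∈ level n → limit ψ ⊎ limit (∼ ψ)
    limit-decides n i with extendAll-decides (stage n) i
    -- The formulas of `level n` are settled only on passing to stage `suc n`.
    ... | inj₁ x = inj₁ (suc n , x)
    ... | inj₂ x = inj₂ (suc n , x)

  -- Derived rules of KB5°

  module Completeness {P : Set} (p q : P) (p≢q : p ≢ q) (Γ : Pred (Formula P) 0ℓ) where

    Ax : Pred (Formula P) 0ℓ
    Ax = KB5°-Axiom p q

    ⊢_ : Pred (Formula P) 0ℓ
    ⊢_ = Derives Ax Γ

    infix 4 ⊢_

    justified-⊆ : ∀ {φs ψs φ} → φs ⊆ ψs → Justified Ax Γ φs φ → Justified Ax Γ ψs φ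
    justified-⊆ i (axiom-instance a σ)       = axiom-instance a σ
    justified-⊆ i (premise x)                = premise x
    justified-⊆ i (uniform-substitution x σ) = uniform-substitution (i x) σ
    justified-⊆ i (modus-ponens x y)         = modus-ponens (i x) (i y)
    justified-⊆ i (∘-monotonicity x)         = ∘-monotonicity (i x)

    _++ᴰ_ : ∀ {φs ψs} → IsDerivation Ax Γ φs → IsDerivation Ax Γ ψs →
            IsDerivation Ax Γ (φs ++ ψs)
    []      ++ᴰ e = e
    (j ∷ d) ++ᴰ e = justified-⊆ ∈-++⁺ˡ j ∷ (d ++ᴰ e)

    ⊢-axiom : ∀ {α} → Ax α → ∀ σ → ⊢ α [ σ ]
    ⊢-axiom a σ = [] , axiom-instance a σ ∷ []

    -- Makes `Γ` true in a model whose worlds decide collapsed formulas only.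
    ⊢-premise-[] : ∀ {γ} → Γ γ → ∀ σ → ⊢ γ [ σ ]
    ⊢-premise-[] x σ = -, uniform-substitution (here refl) σ ∷ premise x ∷ []

    ⊢-∘-monotonicity : ∀ {φ ψ} → ⊢ φ ⇒ ψ → ⊢ ∘ φ ∧ φ ⇒ ∘ ψ
    ⊢-∘-monotonicity (_ , d) = -, ∘-monotonicity (here refl) ∷ d

    ⊢-modus-ponens : ∀ {φ ψ} → ⊢ φ ⇒ ψ → ⊢ φ → ⊢ ψ
    ⊢-modus-ponens {φ} {ψ} (φs , d) (_ , e) =
      -, modus-ponens (here refl) (∈-++⁺ʳ ((φ ⇒ ψ) ∷ φs) (here refl)) ∷ (d ++ᴰ e)

    ⊢-tautology : ∀ {φ} → Tautology φ → ⊢ φ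
    ⊢-tautology {φ} t =
      subst ⊢_ ([]-fixed φ {var} λ _ → refl) (⊢-axiom (K° (tautology {φ = φ} t)) var)

    ⊢-isFilter : IsFilter ⊢_
    ⊢-isFilter = record { tautological = ⊢-tautology ; detach = ⊢-modus-ponens }

    module ⊢ = IsFilter ⊢-isFilter

    -- Instantiates an axiom in `p` and `q` at two formulas. Every variable other than `p` gets the
    -- second one, and `p≢q` ensures that `q` does.
    assign : Formula P → Formula P → P → Formula P
    assign φ ψ r with em {r ≡ p}
    ... | yes _ = φ
    ... | no  _ = ψ

    assign-p : ∀ φ ψ → assign φ ψ p ≡ φ
    assign-p φ ψ with em {p ≡ p}
    ... | yes _  = refl
    ... | no p≢p = contradiction refl p≢p

    assign-q : ∀ φ ψ → assign φ ψ q ≡ ψ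
    assign-q φ ψ with em {q ≡ p}
    ... | yes q≡p = contradiction (sym q≡p) p≢q
    ... | no  _   = refl

    ⊢-∘-∧ : ∀ φ ψ → ⊢ ∘ φ ∧ ∘ ψ ⇒ ∘ (φ ∧ ψ)
    ⊢-∘-∧ φ ψ = subst₂ (λ a b → ⊢ ∘ a ∧ ∘ b ⇒ ∘ (a ∧ b)) (assign-p φ ψ) (assign-q φ ψ)
                       (⊢-axiom (K° ∘p∧∘q) (assign φ ψ))

    -- Necessitation: monotonicity applied to truth implying `φ`, together with `∘⊤`.
    ⊢-□ : ∀ {φ} → ⊢ φ → ⊢ □ φ
    ⊢-□ x = ⊢.∧-intro x
      (⊢-modus-ponens (⊢-∘-monotonicity (⊢.weakening x))
                      -- `⊤[ p ]` unfolds to `var p ⇒ var p`, hence `⇒-refl`.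
                      (⊢.∧-intro (⊢-axiom (K° ∘⊤) var) ⊢.⇒-refl))

    -- Closure of a filter containing all derivable formulas

    module ⊢-Filter {Θ : Pred (Formula P) 0ℓ} (Θ-isFilter : IsFilter Θ) (⊢⊑Θ : ⊢_ ⊑ Θ) where
      open IsFilter Θ-isFilter

      ∘-mono : ∀ {φ ψ} → ⊢ φ ⇒ ψ → Θ φ → Θ (∘ φ) → Θ (∘ ψ)
      ∘-mono φ⇒ψ x ∘x = detach (⊢⊑Θ (⊢-∘-monotonicity φ⇒ψ)) (∧-intro ∘x x)

      □-mono : ∀ {φ ψ} → ⊢ φ ⇒ ψ → Θ (□ φ) → Θ (□ ψ)
      □-mono φ⇒ψ x = ∧-intro (detach (⊢⊑Θ φ⇒ψ) (∧-elimˡ x)) (∘-mono φ⇒ψ (∧-elimˡ x) (∧-elimʳ x))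

      □-∧ : ∀ {φ ψ} → Θ (□ φ) → Θ (□ ψ) → Θ (□ (φ ∧ ψ))
      □-∧ {φ} {ψ} x y =
        ∧-intro (∧-intro (∧-elimˡ x) (∧-elimˡ y))
                (detach (⊢⊑Θ (⊢-∘-∧ φ ψ)) (∧-intro (∧-elimʳ x) (∧-elimʳ y)))

      -- Normality of `□_`: necessitation handles tautologies, and boxes are conjoined before modus
      -- ponens is applied under the box. Lindenbaum's lemma starts from this filter to produce
      -- successors.
      □⁻¹-isFilter : IsFilter (λ χ → Θ (□ χ))
      □⁻¹-isFilter = record
        { tautological = λ t → ⊢⊑Θ (⊢-□ (⊢-tautology t))
        ; detach       = λ x y → □-mono ⊢-detach (□-∧ x y)
        }
        where
        ⊢-detach : ∀ {φ ψ} → ⊢ (φ ⇒ ψ) ∧ φ ⇒ ψ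
        ⊢-detach {φ} {ψ} = A.detach (A.∧-elimˡ ⊢.⇒-refl) (A.∧-elimʳ ⊢.⇒-refl)
          where module A = IsFilter (⊢.adjoin-isFilter ((φ ⇒ ψ) ∧ φ))

    -- Both characteristic axioms, with ∼χ for p, put this premise under ∘.
    ⊢-B⇒∼□ : ∀ χ → ⊢ (∘ ∼ ∼ χ ⇒ ∼ χ) ⇒ ∼ □ χ
    ⊢-B⇒∼□ χ = ⊢.contraposition
      (A.∼∼-intro (A.∧-intro
        (B.∘-mono (⊢-tautology (double-negation-intro-tautology χ)) χ∈ (A.∧-elimʳ ⊢.⇒-refl))
        (A.∼∼-intro χ∈)))
      where
      adjoined = ⊢.adjoin-isFilter (□ χ)
      module A = IsFilter adjoined
      module B = ⊢-Filter adjoined ⊢.weakening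
      χ∈ = A.∧-elimˡ {χ} {∘ χ} ⊢.⇒-refl

    -- The canonical model over the variables of φ

    module Canonical (vs : List P) (p∈vs : p ∈ vs) where

      τ : P → Formula P
      τ r with em {r ∈ vs}
      ... | yes _ = var r
      ... | no  _ = var p

      τ-∈ : ∀ {r} → r ∈ vs → τ r ≡ var r
      τ-∈ {r} i with em {r ∈ vs}
      ... | yes _ = refl
      ... | no ¬i = contradiction i ¬i

      τ-image : ∀ r → τ r ∈ map var vs
      τ-image r with em {r ∈ vs}
      ... | yes i = ∈-map⁺ var i
      ... | no  _ = ∈-map⁺ var p∈vs

      -- Cumulative finite lists that together exhaust the formulas over `vs`.
      level : ℕ → List (Formula P)
      level zero    = map var vs
      level (suc n) = level n ++ map ∼_ (level n) ++ map ∘_ (level n) ++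
                      cartesianProductWith _∧_ (level n) (level n)

      level-mono : ∀ {m n} → m ≤′ n → level m ⊆ level n
      level-mono ≤′-refl       = λ i → i
      level-mono (≤′-step m≤n) = ∈-++⁺ˡ ∘′ level-mono m≤n

      rank : Formula P → ℕ
      rank (var r) = 0
      rank (∼ φ)   = suc (rank φ)
      rank (φ ∧ ψ) = suc (rank φ ⊔ rank ψ)
      rank (∘ φ)   = suc (rank φ)

      ∈-level : ∀ φ → φ [ τ ] ∈ level (rank φ)
      ∈-level (var r) = τ-image r
      ∈-level (∼ φ)   = ∈-++⁺ʳ (level (rank φ)) (∈-++⁺ˡ (∈-map⁺ ∼_ (∈-level φ)))
      ∈-level (∘ φ)   =
        ∈-++⁺ʳ l (∈-++⁺ʳ (map ∼_ l) (∈-++⁺ˡ (∈-map⁺ ∘_ (∈-level φ))))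
        where l = level (rank φ)
      ∈-level (φ ∧ ψ) =
        ∈-++⁺ʳ l (∈-++⁺ʳ (map ∼_ l) (∈-++⁺ʳ (map ∘_ l) (∈-cartesianProductWith⁺ _∧_
          (level-mono (≤⇒≤′ (m≤m⊔n (rank φ) (rank ψ))) (∈-level φ))
          (level-mono (≤⇒≤′ (m≤n⊔m (rank φ) (rank ψ))) (∈-level ψ)))))
        where l = level (rank φ ⊔ rank ψ)

      -- Maximality is demanded on the image of `τ` only; elsewhere a world may leave formulas
      -- undecided.
      record World : Set where
        field
          member     : Formula P → Bool
          isFilter   : IsFilter (λ χ → T (member χ))
          extends    : ⊢_ ⊑ λ χ → T (member χ)
          consistent : ∀ χ → T (member χ) → ¬ T (member (∼ χ))
          decides    : ∀ χ → T (member (χ [ τ ])) ⊎ T (member (∼ χ [ τ ]))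

        open IsFilter isFilter public
        open ⊢-Filter isFilter extends public

        ∼-intro : ∀ χ → ¬ T (member (χ [ τ ])) → T (member (∼ χ [ τ ]))
        ∼-intro χ ¬x with decides χ
        ... | inj₁ x = contradiction x ¬x
        ... | inj₂ y = y

        ∼-elim : ∀ χ → T (member (∼ χ)) → ¬ T (member χ)
        ∼-elim χ y x = consistent χ x y

        -- Both cases box `∘ ∼ ∼ χ ⇒ ∼ χ`. If `∼ χ` is in the world, it gives this implication
        -- outright and `p⇒` puts it under `∘_`. If `χ` is, then `∘ ∼ ∼ χ` must fail, so the
        -- implication is vacuous and `∼∘∼p⇒` applies.
        negative-introspection : ∀ χ → T (member (∼ □ χ [ τ ])) → T (member (□ ∼ □ χ [ τ ]))
        negative-introspection χ ∼□χ with decides χ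
        ... | inj₂ ∼χ = □-mono (⊢-B⇒∼□ _)
              (∧-intro (weakening ∼χ) (detach (extends (⊢-axiom p⇒ λ _ → ∼ χ [ τ ])) ∼χ))
        ... | inj₁ χ∈ = □-mono (⊢-B⇒∼□ _)
              (∧-intro (explosion ∼∘) (detach (extends (⊢-axiom ∼∘∼p⇒ λ _ → ∼ χ [ τ ])) ∼∘))
          where
          ∼∘ : T (member (∼ ∘ ∼ ∼ χ [ τ ]))
          -- Given `χ`, monotonicity would turn `∘ ∼ ∼ χ` into `∘ χ`, contradicting `∼ □ χ`.
          ∼∘ = ∼-intro (∘ ∼ ∼ χ) λ x → ∼-elim _ ∼□χ
            (∧-intro χ∈ (∘-mono (⊢-tautology (double-negation-elim-tautology (χ [ τ ]))) (∼∼-intro χ∈) x))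

      infix 4 _∋_
      _∋_ : World → Pred (Formula P) 0ℓ
      w ∋ χ = T (World.member w χ)

      world : ∀ {Θ} → IsFilter Θ → ⊢_ ⊑ Θ → ∀ φ → φ ∉ Θ →
              ∃[ w ] (∀ χ → Θ χ → w ∋ χ) × ¬ w ∋ φ
      world {Θ} Θ-isFilter ⊢⊑Θ φ φ∉Θ = w , (λ _ x → into (limit-extends x)) , limit-avoids ∘′ out
        where
        open Lindenbaum level Θ-isFilter φ φ∉Θ
        module L = IsFilter limit-isFilter

        into : ∀ {χ} → limit χ → T (⟦ limit ⟧ χ)
        into = fromWitness

        out : ∀ {χ} → T (⟦ limit ⟧ χ) → limit χ
        out = toWitness

        w : World
        w = record
          { member     = ⟦ limit ⟧
          ; isFilter   = record
            { tautological = λ {χ} t → into (L.tautological {χ} t)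
            ; detach       = λ x y → into (L.detach (out x) (out y))
            }
          ; extends    = λ x → into (limit-extends (⊢⊑Θ x))
          -- A contradiction would put `φ` into the limit by explosion.
          ; consistent = λ χ x y → limit-avoids (L.detach (L.explosion (out y)) (out x))
          ; decides    = λ χ → ⊎.map into into (limit-decides (rank χ) (∈-level χ))
          }

      -- The canonical frame and the truth lemma

      _▷_ : World → World → Set
      w ▷ u = ∀ χ → w ∋ □ χ [ τ ] → u ∋ χ [ τ ]

      -- Negative introspection sends the failure of a box to all successors; both frame conditions
      -- are reduced to this by contradiction.
      ▷-refute : ∀ {w u} → w ▷ u → ∀ χ → w ∋ ∼ □ χ [ τ ] → ¬ u ∋ □ χ [ τ ]
      ▷-refute {w} {u} w▷u χ x =
        World.∼-elim u _ (w▷u (∼ □ χ) (World.negative-introspection w χ x))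

      canonical : World → Frame
      canonical w = record { S = World ; R = _▷_ ; inhabited = w }

      canonical-B5 : ∀ w → B5 (canonical w)
      canonical-B5 _ = (λ {w} {u} → symmetric {w} {u}) , λ {w} {u} {v} → euclidean {w} {u} {v}
        where
        symmetric : ∀ {w u} → w ▷ u → u ▷ w
        -- `□ χ` has `χ` as a conjunct, so it fails at `w` along with `χ`.
        symmetric {w} {u} w▷u χ □χ∈u = stable λ χ∉w → ▷-refute {w} {u} w▷u χ
          (World.∼-intro w (□ χ) λ □χ∈w → χ∉w (World.∧-elimˡ w □χ∈w)) □χ∈u

        euclidean : ∀ {w u v} → w ▷ u → w ▷ v → u ▷ v
        euclidean {w} {u} w▷u w▷v χ □χ∈u = stable λ χ∉v → ▷-refute {w} {u} w▷u χ
          (World.∼-intro w (□ χ) λ □χ∈w → χ∉v (w▷v χ □χ∈w)) □χ∈u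

      -- Reading variables through `τ` lets the truth lemma cover every formula, including premises
      -- with variables outside `vs`.
      valuation : ∀ w → Valuation P (canonical w)
      valuation _ r u = u ∋ τ r

      truth : ∀ w₀ χ w → let Sat′ = Sat (canonical w₀) (valuation w₀) w χ in
              (Sat′ → w ∋ χ [ τ ]) × (w ∋ χ [ τ ] → Sat′)
      truth w₀ (var r) w = (λ x → x) , λ x → x
      truth w₀ (∼ χ)   w =
        (λ ¬x → ∼-intro χ λ x → ¬x (proj₂ (truth w₀ χ w) x)) ,
        λ y x → ∼-elim _ y (proj₁ (truth w₀ χ w) x)
        where open World w
      truth w₀ (χ ∧ ψ) w =
        (λ (x , y) → ∧-intro (proj₁ (truth w₀ χ w) x) (proj₁ (truth w₀ ψ w) y)) ,
        λ z → proj₂ (truth w₀ χ w) (∧-elimˡ z) , proj₂ (truth w₀ ψ w) (∧-elimʳ z)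
        where open World w
      truth w₀ (∘ χ)   w = to , λ x y u w▷u →
        proj₂ (truth w₀ χ u) (w▷u χ (∧-intro (proj₁ (truth w₀ χ w) y) x))
        where
        open World w
        to : Sat (canonical w₀) (valuation w₀) w (∘ χ) → w ∋ ∘ χ [ τ ]
        to f with decides χ
        -- Where `χ` fails, `∘ χ` is automatic by the axiom `∼p⇒∘p`.
        ... | inj₂ ∼χ = detach (extends (⊢-axiom (K° ∼p⇒∘p) λ _ → χ [ τ ])) ∼χ
        -- Otherwise `□ χ` is absent from `w`, and extending the formulas boxed in `w` while
        -- avoiding `χ` gives a successor that contradicts `f`.
        ... | inj₁ χ∈ = stable λ ∘χ∉ →
          let u , w▷u , χ∉u = world □⁻¹-isFilter (λ x → extends (⊢-□ x)) (χ [ τ ])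
                                    (λ □χ → ∘χ∉ (∧-elimʳ □χ))
          in χ∉u (proj₁ (truth w₀ χ u)
               (f (proj₂ (truth w₀ χ w) χ∈) u λ ψ → w▷u (ψ [ τ ])))

    -- If `φ` were underivable, some world would omit it. That world satisfies `Γ`, as the
    -- `τ`-instances of premises are derivable, and refutes `φ`, which `τ` fixes.
    complete : ∀ φ → Entails B5 Γ φ → ⊢ φ
    complete φ Γ⊨φ = stable λ ⊬φ →
      let w , _ , φ∉w = world ⊢-isFilter (λ x → x) φ ⊬φ
          φ-fixed = []-fixed φ λ i → τ-∈ (there i)
      in φ∉w (subst (w ∋_) φ-fixed (proj₁ (truth w φ w)
           (Γ⊨φ (canonical w) (canonical-B5 w) (valuation w) w λ γ x →
             proj₂ (truth w γ w) (World.extends w (⊢-premise-[] x τ)))))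
      -- `p` heads the list so that the target of the collapse is itself listed.
      where open Canonical (p ∷ variables φ) (here refl)

theorem42 : ExcludedMiddle 0ℓ → Extensionality 0ℓ 0ℓ →
    (P : Set) (p q : P) → p ≢ q →
    ((φ : Formula P) → Theorem (KB5°-Axiom p q) φ → ValidOn B5 φ) ×
    ((Γ : Pred (Formula P) 0ℓ) (φ : Formula P) →
    Entails B5 Γ φ → Derives (KB5°-Axiom p q) Γ φ)
theorem42 em _ P p q p≢q =
  (λ φ (_ , d) → lookup (derivation-valid d) (here refl)) ,
  Completeness.complete p q p≢q
  where open Classical em
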